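{- For every positive integer $n$ there exists an algorithm that, for every stack $C$ of $n$ burnt pancakes, produces a sequence of flips transforming $C$ into $I_n$, such that the average length of the produced sequence, taken over all $n!\,2^n$ stacks of $n$ burnt pancakes, is at most \[ \frac74 n+5 . \]
   Context: A stack of $n$ burnt pancakes is a pair $C=(\pi,v)$ with $\pi\in S_n$ and $v\in\{0,1\}^n$: the $i$-th pancake from the top has size $\pi(i)$ and lies burnt side down if $v_i=0$, burnt side up if $v_i=1$. An $i$-flip ($0\le i\le n$) reverses the order of the top $i$ pancakes and switches the orientation of each of them. $I_n$ is the stack with pancakes $1,\dots,n$ from top to bottom, all burnt side down. -}

module Defs where

open import Data.Nat using (ℕ; zero; suc; _∸_; _<_; _≤_; _<?_; s≤s)
open import Data.Nat.Properties using (∸-monoˡ-≤; m∸n≤m; ≤-trans)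
open import Data.Fin using (Fin; toℕ; fromℕ<)
open import Data.Fin.Properties using (toℕ≤pred[n]; _≟_)
open import Data.Bool using (Bool; true; false; not)
open import Data.Product using (_×_; _,_; proj₁; proj₂)
open import Data.List using (List; []; _∷_; [_]; map; concatMap; cartesianProduct; filter; length)
open import Data.Nat.ListAction using (sum)
import Data.List.Relation.Unary.Unique.DecPropositional as UniqueDec
open import Data.Vec using (Vec; []; _∷_; lookup; tabulate; toList)
import Data.Vec as Vec
open import Relation.Nullary using (yes; no)

-- A signed pancake: (size, orientation); orientation false = burnt side down (v_i = 0),
-- true = burnt side up (v_i = 1).  Sizes are 0-based: Fin n stands for {1,…,n}.
Pancake : ℕ → Set
Pancake n = Fin n × Bool

-- Raw stacks of n pancakes, listed from top (index 0) to bottom.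
RawStack : ℕ → Set
RawStack n = Vec (Pancake n) n

sizes : ∀ {n} → RawStack n → List (Fin n)
sizes C = toList (Vec.map proj₁ C)

-- A raw stack is a stack of burnt pancakes iff its sizes are pairwise distinct,
-- i.e. (since there are n entries in Fin n) the sizes form a permutation π ∈ S_n.
IsStack : ∀ {n} → RawStack n → Set
IsStack {n} C = UniqueDec.Unique (_≟_ {n}) (sizes C)

I : (n : ℕ) → RawStack n
I n = tabulate (λ i → (i , false))

toggle : ∀ {n} → Pancake n → Pancake n
toggle (p , b) = (p , not b)

private
  idx-lemma : ∀ {n} (k : Fin (suc n)) (j : Fin n) → toℕ k ∸ suc (toℕ j) < n
  idx-lemma {suc n} k j =
    ≤-trans (s≤s (∸-monoˡ-≤ (suc (toℕ j)) (toℕ≤pred[n] k))) (s≤s (m∸n≤m n (toℕ j)))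

flip : ∀ {n} → Fin (suc n) → RawStack n → RawStack n
flip {n} k C = tabulate f
  where
  f : Fin n → Pancake n
  f j with toℕ j <? toℕ k
  ... | yes _ = toggle (lookup C (fromℕ< (idx-lemma k j)))
  ... | no  _ = lookup C j

applyFlips : ∀ {n} → List (Fin (suc n)) → RawStack n → RawStack n
applyFlips []       C = C
applyFlips (k ∷ ks) C = applyFlips ks (flip k C)

allVecs : ∀ {A : Set} → List A → (m : ℕ) → List (Vec A m)
allVecs xs zero    = [ [] ]
allVecs xs (suc m) = concatMap (λ x → map (x ∷_) (allVecs xs m)) xs

allStacks : (n : ℕ) → List (RawStack n)
allStacks n =
  filter (λ C → UniqueDec.unique? (_≟_ {n}) (sizes C))
         (allVecs (cartesianProduct (Data.List.allFin n) (false ∷ true ∷ [])) n)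

totalLength : ∀ {n} → (RawStack n → List (Fin (suc n))) → ℕ
totalLength {n} alg = sum (map (λ C → length (alg C)) (allStacks n))

{-# OPTIONS --safe #-}
module Submission where

open import Defs
open import Data.Nat using (ℕ; _+_; _*_; _^_; _≤_)
open import Data.Nat using (_!)
open import Data.List using (List)
open import Data.Fin using (Fin)
open import Data.Product using (Σ-syntax; _×_)
open import Relation.Binary.PropositionalEquality using (_≡_)

open import Algebra.Properties.CommutativeSemigroup using (interchange)
open import Data.Bool using (Bool; true; false; not; if_then_else_)
import Data.Bool as Bool
open import Data.Bool.Properties using (not-involutive)
open import Data.Fin using (zero; suc; toℕ; fromℕ<)
open import Data.Fin.Properties using (_≟_; toℕ-fromℕ<; toℕ<n)
open import Data.List
  using ([]; _∷_; [_]; _++_; _∷ʳ_; map; concatMap; reverse; take; drop; length; allFin)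
import Data.List as List
open import Data.List.Membership.Propositional using (_∈_; _∉_; find; lose)
open import Data.List.Membership.Propositional.Properties
  using (∈-++⁻; ∈-++⁺ˡ; ∈-++⁺ʳ; ∈-∃++; ∈-map⁺; ∈-map⁻; ∈-concatMap⁺; ∈-concatMap⁻; ∈-allFin; ∈-filter⁻)
open import Data.List.Properties
  using (∷-injective; ++-assoc; ++-identityʳ; map-++; map-∘; map-id; map-cong; length-map; length-++;
         length-reverse; length-tabulate; length-take; take-all; drop-all; reverse-++; reverse-map;
         reverse-involutive; unfold-reverse; concatMap-++; take++drop≡id)
open import Data.List.Relation.Binary.Permutation.Propositional
  using (_↭_; prep; ↭-refl; ↭-sym; ↭-trans; ↭-reflexive; ↭⇒↭ₛ; module PermutationReasoning)
open import Data.List.Relation.Binary.Permutation.Propositional.Properties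
  using (∈-resp-↭; ↭-length; shift; ++-comm; drop-∷; ↭-reverse; ++⁺ʳ; ∷↭∷ʳ)
  renaming (map⁺ to ↭-map⁺)
import Data.List.Relation.Binary.Permutation.Setoid.Properties as Permutation
open import Data.List.Relation.Unary.All as All using ([]; _∷_)
open import Data.List.Relation.Unary.AllPairs using ([]; _∷_)
open import Data.List.Relation.Unary.Any using (here; there)
import Data.List.Relation.Unary.Unique.DecPropositional as UniqueDec
open import Data.List.Relation.Unary.Unique.Propositional using (Unique)
import Data.List.Relation.Unary.Unique.Propositional.Properties as Unique
open import Data.Maybe using (Maybe; just; nothing)
import Data.Maybe as Maybe
open import Data.Nat using (zero; suc; _<_; _∸_; _⊓_; z≤n; s≤s; _<?_)
open import Data.Nat.ListAction using (sum)
open import Data.Nat.ListAction.Properties using (sum-++; sum-↭)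
open import Data.Nat.Properties hiding (_≟_; _<?_)
open import Data.Nat.Tactic.RingSolver using (solve-∀)
open import Data.Product using (∃-syntax; _,_; proj₁; proj₂)
open import Data.Product.Properties using (≡-dec)
open import Data.Sum using (_⊎_; inj₁; inj₂)
open import Data.Vec using (Vec; []; _∷_; lookup; tabulate; toList)
import Data.Vec as Vec
open import Data.Vec.Properties
  using (toList-map; length-toList; toList-injective; lookup∘tabulate; tabulate-∘; cast-is-id)
  renaming (∷-injective to ∷ᵛ-injective)
open import Function using (_∘_; id; _∋_)
open import Relation.Binary.Definitions using (DecidableEquality)
open import Relation.Binary.PropositionalEquality
  using (_≢_; refl; sym; trans; cong; cong₂; subst; subst₂; setoid; module ≡-Reasoning)
open import Relation.Nullary using (Dec; yes; no; ¬_; contradiction; does)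

-- Sizes are read cyclically and a stack is regarded as a signed word.  One step glues the top pancake b
-- to one of its two cyclic neighbours; a is the pancake that precedes b when the cycle is read in the
-- direction in which b points, c the one that follows it, and bars denote reversed orientation.
--   b A ā B  ↦  Ā b̄ ā B              1 flip,  when a is turned against b;
--   b A c D  ↦  A b c D              3 flips, when a and c are both turned like b;
--   b A c̄ D  ↦  A c̄ b̄ D              2 flips, when only a is turned like b.
-- The glued pair counts as a single pancake from then on, so every step continues with the stack u
-- below b (in the first case with its part above a flipped), which is again uniformly distributed.
-- Hence a step costs 1/2 · 1 + 1/4 · 3 + 1/4 · 2 = 7/4 flips on average, and the word
-- obtained at the end is I n up to rotation and reversal, which at most 4 further flips repair.

-- Lists: permutations, sums and freedom from duplicates.

Unique-resp-↭ : ∀ {A : Set} {xs ys : List A} → xs ↭ ys → Unique xs → Unique ys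
Unique-resp-↭ {A} p = Permutation.Unique-resp-↭ (setoid A) (↭⇒↭ₛ p)

∈-++-remove : ∀ {A : Set} {x y : A} l {r} → x ∈ l ++ y ∷ r → x ≢ y → x ∈ l ++ r
∈-++-remove l x∈ x≢y with ∈-++⁻ l x∈
... | inj₁ x∈l = ∈-++⁺ˡ x∈l
... | inj₂ (here eq) = contradiction eq x≢y
... | inj₂ (there x∈r) = ∈-++⁺ʳ l x∈r

-- The images `g x` are struck out of `ys` one after another; injectivity keeps the images still to
-- come in the list, and whatever is left over at the end only adds to the right-hand sum.
sum-injection≤ : ∀ {A B : Set} (f : B → ℕ) (g : A → B) {xs : List A} {ys : List B} → Unique xs →
  (∀ {x} → x ∈ xs → g x ∈ ys) →
  (∀ {x y} → x ∈ xs → y ∈ xs → g x ≡ g y → x ≡ y) →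
  sum (map (f ∘ g) xs) ≤ sum (map f ys)
sum-injection≤ f g {[]} _ _ _ = z≤n
sum-injection≤ f g {x ∷ xs} {ys} (x∉ ∷ uniq) mem inj with ∈-∃++ (mem (here refl))
... | l , r , refl = begin
  f (g x) + sum (map (f ∘ g) xs) ≤⟨ +-monoʳ-≤ (f (g x))
     (sum-injection≤ f g uniq
       (λ y∈ → ∈-++-remove l (mem (there y∈))
         λ eq → All.lookup x∉ y∈ (sym (inj (there y∈) (here refl) eq)))
       (λ p q → inj (there p) (there q))) ⟩
  f (g x) + sum (map f (l ++ r)) ≡⟨ sum-↭ (↭-map⁺ f (shift (g x) l r)) ⟨
  sum (map f (l ++ g x ∷ r)) ∎
  where open ≤-Reasoning

-- Pigeonhole: each entry of `xs` removes one entry of `ys`, and the bound on lengths leaves nothing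
-- over.
Unique-⊆-↭ : ∀ {A : Set} {xs ys : List A} → Unique xs → (∀ {x} → x ∈ xs → x ∈ ys) →
  length ys ≤ length xs → xs ↭ ys
Unique-⊆-↭ {xs = []} {[]} _ _ _ = ↭-refl
Unique-⊆-↭ {xs = x ∷ xs} (x∉ ∷ uniq) sub len with ∈-∃++ (sub (here refl))
... | l , r , refl = ↭-trans
  (prep x (Unique-⊆-↭ uniq
    (λ y∈ → ∈-++-remove l (sub (there y∈)) λ eq → All.lookup x∉ y∈ (sym eq))
    (≤-pred (≤-trans (≤-reflexive (sym (↭-length (shift x l r)))) len))))
  (↭-sym (shift x l r))

sum-map-mono : ∀ {A : Set} {f g : A → ℕ} (xs : List A) →
  (∀ {x} → x ∈ xs → f x ≤ g x) → sum (map f xs) ≤ sum (map g xs)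
sum-map-mono [] _ = z≤n
sum-map-mono (x ∷ xs) h = +-mono-≤ (h (here refl)) (sum-map-mono xs (h ∘ there))

sum-map-+ : ∀ {A : Set} (f g : A → ℕ) xs →
  sum (map (λ x → f x + g x) xs) ≡ sum (map f xs) + sum (map g xs)
sum-map-+ f g [] = refl
sum-map-+ f g (x ∷ xs) rewrite sum-map-+ f g xs =
  interchange +-commutativeSemigroup (f x) (g x) (sum (map f xs)) (sum (map g xs))

sum-map-const : ∀ {A : Set} k (xs : List A) → sum (map (λ _ → k) xs) ≡ length xs * k
sum-map-const k [] = refl
sum-map-const k (x ∷ xs) = cong (k +_) (sum-map-const k xs)

sum-map-concatMap : ∀ {A B : Set} (f : B → ℕ) (h : A → List B) xs →
  sum (map f (concatMap h xs)) ≡ sum (map (λ x → sum (map f (h x))) xs)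
sum-map-concatMap f h [] = refl
sum-map-concatMap f h (x ∷ xs) = begin
  sum (map f (h x ++ concatMap h xs)) ≡⟨ cong sum (map-++ f (h x) _) ⟩
  sum (map f (h x) ++ map f (concatMap h xs)) ≡⟨ sum-++ (map f (h x)) _ ⟩
  sum (map f (h x)) + sum (map f (concatMap h xs)) ≡⟨ cong (_ +_) (sum-map-concatMap f h xs) ⟩
  sum (map f (h x)) + sum (map (λ x → sum (map f (h x))) xs) ∎
  where open ≡-Reasoning

-- Two cuts of one list: `m` is the segment between them.
++-split : ∀ {A : Set} (p : List A) {q} p′ {q′} → p ++ q ≡ p′ ++ q′ →
  (∃[ m ] (p ≡ p′ ++ m × q′ ≡ m ++ q)) ⊎ (∃[ m ] (p′ ≡ p ++ m × q ≡ m ++ q′))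
++-split [] p′ eq = inj₂ (p′ , refl , eq)
++-split (x ∷ p) [] eq = inj₁ (x ∷ p , refl , sym eq)
++-split (x ∷ p) (y ∷ p′) eq with ∷-injective eq
... | refl , eq′ with ++-split p p′ eq′
...   | inj₁ (m , refl , refl) = inj₁ (m , refl , refl)
...   | inj₂ (m , refl , refl) = inj₂ (m , refl , refl)

take-length-++ : ∀ {A : Set} (xs ys : List A) → take (length xs) (xs ++ ys) ≡ xs
take-length-++ [] ys = refl
take-length-++ (x ∷ xs) ys = cong (x ∷_) (take-length-++ xs ys)

drop-length-++ : ∀ {A : Set} (xs ys : List A) → drop (length xs) (xs ++ ys) ≡ ys
drop-length-++ [] ys = refl
drop-length-++ (x ∷ xs) ys = drop-length-++ xs ys

-- Since `f x y` determines `x`, blocks that belong to different `x` are disjoint. The lemma serves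
-- both enumerations, `stacks` and `allVecs`.
Unique-concatMap : ∀ {X Y Z : Set} (f : X → Y → Z) (h : X → List Y) →
  (∀ {x x′ y y′} → f x y ≡ f x′ y′ → x ≡ x′ × y ≡ y′) →
  ∀ xs → Unique xs → (∀ {x} → x ∈ xs → Unique (h x)) →
  Unique (concatMap (λ x → map (f x) (h x)) xs)
Unique-concatMap f h inj [] _ _ = []
Unique-concatMap f h inj (x ∷ xs) (x∉ ∷ uniq) uniqh =
  Unique.++⁺ (Unique.map⁺ (proj₂ ∘ inj) (uniqh (here refl)))
             (Unique-concatMap f h inj xs uniq (uniqh ∘ there))
             disjoint
  where
  disjoint : ∀ {z} → ¬ (z ∈ map (f x) (h x) × z ∈ concatMap (λ x → map (f x) (h x)) xs)
  disjoint (z∈ , z∈′) with ∈-map⁻ (f x) z∈ | find (∈-concatMap⁻ (λ x → map (f x) (h x)) {xs = xs} z∈′)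
  ... | y , _ , refl | x′ , x′∈ , z∈″ with ∈-map⁻ (f x′) z∈″
  ...   | _ , _ , eq = All.lookup x∉ x′∈ (proj₁ (inj eq))

Unique-∉-∷ : ∀ {A : Set} xs {y : A} {ys} → Unique (xs ++ y ∷ ys) → y ∉ ys
Unique-∉-∷ xs {y} {ys} uniq y∈ with Unique-resp-↭ (shift y xs ys) uniq
... | y∉ ∷ _ = All.lookup y∉ (∈-++⁺ʳ xs y∈) refl

sum≤sum-involution : ∀ {A : Set} (f : A → ℕ) (g : A → A) {xs : List A} → Unique xs →
  (∀ {x} → x ∈ xs → g x ∈ xs) → (∀ {x} → x ∈ xs → g (g x) ≡ x) →
  sum (map f xs) ≤ sum (map (f ∘ g) xs)
sum≤sum-involution f g {xs} uniq mem invol = ≤-trans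
  (sum-map-mono xs (λ x∈ → ≤-reflexive (cong f (sym (invol x∈)))))
  (sum-injection≤ (f ∘ g) g uniq mem
    λ x∈ y∈ eq → trans (sym (invol x∈)) (trans (cong g eq) (invol y∈)))

-- Signed words and their inverses.

module Words {A : Set} (_≟ᴬ_ : DecidableEquality A) where

  _≟ˢ_ : DecidableEquality (A × Bool)
  _≟ˢ_ = ≡-dec _≟ᴬ_ Bool._≟_

  labels : List (A × Bool) → List A
  labels = map proj₁

  neg : A × Bool → A × Bool
  neg (l , s) = l , not s

  neg-involutive : ∀ x → neg (neg x) ≡ x
  neg-involutive (l , s) = cong (l ,_) (not-involutive s)

  neg≢ : ∀ x → neg x ≢ x
  neg≢ (_ , false) ()
  neg≢ (_ , true) ()

  ≡⊎≡neg : ∀ x y → proj₁ x ≡ proj₁ y → x ≡ y ⊎ x ≡ neg y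
  ≡⊎≡neg (_ , false) (_ , false) refl = inj₁ refl
  ≡⊎≡neg (_ , false) (_ , true)  refl = inj₂ refl
  ≡⊎≡neg (_ , true)  (_ , false) refl = inj₂ refl
  ≡⊎≡neg (_ , true)  (_ , true)  refl = inj₁ refl

  inv : List (A × Bool) → List (A × Bool)
  inv xs = reverse (map neg xs)

  inv-++ : ∀ xs ys → inv (xs ++ ys) ≡ inv ys ++ inv xs
  inv-++ xs ys = trans (cong reverse (map-++ neg xs ys)) (reverse-++ (map neg xs) (map neg ys))

  inv-∷ : ∀ x xs → inv (x ∷ xs) ≡ inv xs ∷ʳ neg x
  inv-∷ x = inv-++ [ x ]

  inv-involutive : ∀ xs → inv (inv xs) ≡ xs
  inv-involutive xs = begin
    reverse (map neg (reverse (map neg xs))) ≡⟨ cong reverse (reverse-map neg (map neg xs)) ⟩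
    reverse (reverse (map neg (map neg xs))) ≡⟨ reverse-involutive _ ⟩
    map neg (map neg xs)                     ≡⟨ map-∘ xs ⟨
    map (neg ∘ neg) xs                       ≡⟨ map-cong neg-involutive xs ⟩
    map id xs                                ≡⟨ map-id xs ⟩
    xs ∎
    where open ≡-Reasoning

  length-inv : ∀ xs → length (inv xs) ≡ length xs
  length-inv xs = trans (length-reverse (map neg xs)) (length-map neg xs)

  labels-inv : ∀ xs → labels (inv xs) ↭ labels xs
  labels-inv xs = ↭-trans (↭-map⁺ proj₁ (↭-reverse (map neg xs))) (↭-reflexive (sym (map-∘ xs)))

  -- Words up to rotation and reversal.

  infix 4 _∼_ _≋_

  data _∼_ : List (A × Bool) → List (A × Bool) → Set where
    rot : ∀ p q → q ++ p ∼ p ++ q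

  ∼-refl : ∀ {t} → t ∼ t
  ∼-refl {t} = subst (_∼ t) (++-identityʳ t) (rot [] t)

  private
    -- The middle word carries two cuts. The segment `m` between them is what both rotations move or
    -- what neither moves separately, so regrouping around `m` exhibits the composite as a single
    -- rotation.
    ∼-trans′ : ∀ p q p′ q′ → p ++ q ≡ q′ ++ p′ → q ++ p ∼ p′ ++ q′
    ∼-trans′ p q p′ q′ eq with ++-split p q′ eq
    ... | inj₁ (m , refl , refl) =
      subst₂ _∼_ (++-assoc q q′ m) (sym (++-assoc m q q′)) (rot m (q ++ q′))
    ... | inj₂ (m , refl , refl) =
      subst₂ _∼_ (sym (++-assoc m p′ p)) (++-assoc p′ p m) (rot (p′ ++ p) m)

  ∼-trans : ∀ {t s o} → t ∼ s → s ∼ o → t ∼ o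
  ∼-trans = go refl
    where
    -- Two copies of the middle word, linked by an equation, let both rotations be matched on.
    go : ∀ {t s s′ o} → s ≡ s′ → t ∼ s → s′ ∼ o → t ∼ o
    go eq (rot p q) (rot p′ q′) = ∼-trans′ p q p′ q′ eq

  ∼-inv : ∀ {t s} → t ∼ s → inv t ∼ inv s
  ∼-inv (rot p q) = subst₂ _∼_ (sym (inv-++ q p)) (sym (inv-++ p q)) (rot (inv q) (inv p))

  ∼-labels : ∀ {t s} → t ∼ s → labels t ↭ labels s
  ∼-labels (rot p q) = ↭-map⁺ proj₁ (++-comm q p)

  -- Equality of cycles that may also be turned over; the recursion reaches its goal only up to this
  -- relation.
  _≋_ : List (A × Bool) → List (A × Bool) → Set
  t ≋ o = t ∼ o ⊎ t ∼ inv o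

  ≋-trans : ∀ {t s o} → t ≋ s → s ≋ o → t ≋ o
  ≋-trans (inj₁ p) (inj₁ q) = inj₁ (∼-trans p q)
  ≋-trans (inj₁ p) (inj₂ q) = inj₂ (∼-trans p q)
  ≋-trans (inj₂ p) (inj₁ q) = inj₂ (∼-trans p (∼-inv q))
  ≋-trans {o = o} (inj₂ p) (inj₂ q) =
    inj₁ (∼-trans p (subst (_ ∼_) (inv-involutive o) (∼-inv q)))

  ≋-labels : ∀ {t s} → t ≋ s → labels t ↭ labels s
  ≋-labels (inj₁ p) = ∼-labels p
  ≋-labels {s = s} (inj₂ p) = ↭-trans (∼-labels p) (labels-inv s)

  -- Flips of words.

  flipL : ℕ → List (A × Bool) → List (A × Bool)
  flipL k s = inv (take k s) ++ drop k s

  flipL-++ : ∀ xs ys → flipL (length xs) (xs ++ ys) ≡ inv xs ++ ys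
  flipL-++ xs ys = cong₂ (λ a b → inv a ++ b) (take-length-++ xs ys) (drop-length-++ xs ys)

  flipL-all : ∀ xs → flipL (length xs) xs ≡ inv xs
  flipL-all xs = begin
    flipL (length xs) xs         ≡⟨ cong (flipL (length xs)) (++-identityʳ xs) ⟨
    flipL (length xs) (xs ++ []) ≡⟨ flipL-++ xs [] ⟩
    inv xs ++ []                 ≡⟨ ++-identityʳ _ ⟩
    inv xs ∎
    where open ≡-Reasoning

  applyL : List ℕ → List (A × Bool) → List (A × Bool)
  applyL []       s = s
  applyL (k ∷ ks) s = applyL ks (flipL k s)

  applyL-++ : ∀ ks js s → applyL (ks ++ js) s ≡ applyL js (applyL ks s)
  applyL-++ []       js s = refl
  applyL-++ (k ∷ ks) js s = applyL-++ ks js (flipL k s)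

  -- The three flips run through `q p`, `q̄ p`, `p̄ q`, `p q`.
  unrotate : ∀ {t o} → t ∼ o → Σ[ w ∈ List ℕ ] (applyL w t ≡ o × length w ≡ 3)
  unrotate (rot p q) = length q ∷ length (inv q ++ p) ∷ length p ∷ [] , eq , refl
    where
    open ≡-Reasoning
    eq : applyL (length q ∷ length (inv q ++ p) ∷ length p ∷ []) (q ++ p) ≡ p ++ q
    eq = begin
      flipL (length p) (flipL (length (inv q ++ p)) (flipL (length q) (q ++ p)))
        ≡⟨ cong (flipL (length p) ∘ flipL (length (inv q ++ p))) (flipL-++ q p) ⟩
      flipL (length p) (flipL (length (inv q ++ p)) (inv q ++ p))
        ≡⟨ cong (flipL (length p)) (flipL-all (inv q ++ p)) ⟩
      flipL (length p) (inv (inv q ++ p))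
        ≡⟨ cong (flipL (length p)) (trans (inv-++ (inv q) p) (cong (inv p ++_) (inv-involutive q))) ⟩
      flipL (length p) (inv p ++ q)
        ≡⟨ cong (λ k → flipL k (inv p ++ q)) (length-inv p) ⟨
      flipL (length (inv p)) (inv p ++ q)
        ≡⟨ flipL-++ (inv p) q ⟩
      inv (inv p) ++ q
        ≡⟨ cong (_++ q) (inv-involutive p) ⟩
      p ++ q ∎

  -- If the cycle is turned over, one flip of the whole stack comes first, which gives the fourth
  -- flip.
  finish : ∀ {t o} → t ≋ o → Σ[ w ∈ List ℕ ] (applyL w t ≡ o × length w ≤ 4)
  finish (inj₁ p) with unrotate p
  ... | w , eq , len = w , eq , ≤-trans (≤-reflexive len) (n≤1+n 3)
  finish {t} {o} (inj₂ p) with unrotate (subst (inv t ∼_) (inv-involutive o) (∼-inv p))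
  ... | w , eq , len = length t ∷ w , trans (cong (applyL w) (flipL-all t)) eq , s≤s (≤-reflexive len)

  -- Substituting words for letters.

  -- A glued block turns over together with the letter that stands for it. This is `τ-neg`; it makes
  -- `τ*` commute with `inv`, hence with flips that cut between blocks.
  module Substitution (τ : A × Bool → List (A × Bool)) (τ-neg : ∀ x → τ (neg x) ≡ inv (τ x)) where

    τ* : List (A × Bool) → List (A × Bool)
    τ* = concatMap τ

    τ*-inv : ∀ xs → τ* (inv xs) ≡ inv (τ* xs)
    τ*-inv [] = refl
    τ*-inv (x ∷ xs) = begin
      τ* (inv (x ∷ xs))            ≡⟨ cong τ* (inv-∷ x xs) ⟩
      τ* (inv xs ∷ʳ neg x)         ≡⟨ concatMap-++ τ (inv xs) [ neg x ] ⟩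
      τ* (inv xs) ++ τ (neg x) ++ [] ≡⟨ cong₂ _++_ (τ*-inv xs) (trans (++-identityʳ _) (τ-neg x)) ⟩
      inv (τ* xs) ++ inv (τ x)     ≡⟨ inv-++ (τ x) (τ* xs) ⟨
      inv (τ x ++ τ* xs) ∎
      where open ≡-Reasoning

    -- A flip that cuts s between two letters cuts τ* s between the corresponding blocks.
    lift : List ℕ → List (A × Bool) → List ℕ
    lift []       s = []
    lift (k ∷ ks) s = length (τ* (take k s)) ∷ lift ks (flipL k s)

    length-lift : ∀ ks s → length (lift ks s) ≡ length ks
    length-lift []       s = refl
    length-lift (k ∷ ks) s = cong suc (length-lift ks (flipL k s))

    flipL-τ* : ∀ k s → flipL (length (τ* (take k s))) (τ* s) ≡ τ* (flipL k s)
    flipL-τ* k s = begin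
      flipL (length (τ* u)) (τ* s)        ≡⟨ cong (flipL (length (τ* u)) ∘ τ*) (take++drop≡id k s) ⟨
      flipL (length (τ* u)) (τ* (u ++ v)) ≡⟨ cong (flipL (length (τ* u))) (concatMap-++ τ u v) ⟩
      flipL (length (τ* u)) (τ* u ++ τ* v) ≡⟨ flipL-++ (τ* u) (τ* v) ⟩
      inv (τ* u) ++ τ* v                  ≡⟨ cong (_++ τ* v) (τ*-inv u) ⟨
      τ* (inv u) ++ τ* v                  ≡⟨ concatMap-++ τ (inv u) v ⟨
      τ* (inv u ++ v) ∎
      where
      open ≡-Reasoning
      u = take k s
      v = drop k s

    applyL-lift : ∀ ks s → applyL (lift ks s) (τ* s) ≡ τ* (applyL ks s)
    applyL-lift []       s = refl
    applyL-lift (k ∷ ks) s = trans (cong (applyL (lift ks (flipL k s))) (flipL-τ* k s))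
                                   (applyL-lift ks (flipL k s))

    ∼-τ* : ∀ {t o} → t ∼ o → τ* t ∼ τ* o
    ∼-τ* (rot p q) = subst₂ _∼_ (sym (concatMap-++ τ q p)) (sym (concatMap-++ τ p q)) (rot (τ* p) (τ* q))

    ≋-τ* : ∀ {t o} → t ≋ o → τ* t ≋ τ* o
    ≋-τ* (inj₁ p) = inj₁ (∼-τ* p)
    ≋-τ* {o = o} (inj₂ p) = inj₂ (subst (_ ∼_) (τ*-inv o) (∼-τ* p))

  replace : A × Bool → List (A × Bool) → A × Bool → List (A × Bool)
  replace a v x with x ≟ˢ a | x ≟ˢ neg a
  ... | yes _ | _     = v
  ... | no _  | yes _ = inv v
  ... | no _  | no _  = [ x ]

  replace-≡ : ∀ a v → replace a v a ≡ v
  replace-≡ a v with a ≟ˢ a | a ≟ˢ neg a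
  ... | yes _ | _ = refl
  ... | no ¬p | _ = contradiction refl ¬p

  replace-neg : ∀ a v → replace a v (neg a) ≡ inv v
  replace-neg a v with neg a ≟ˢ a | neg a ≟ˢ neg a
  ... | yes p | _     = contradiction p (neg≢ a)
  ... | no _  | yes _ = refl
  ... | no _  | no ¬p = contradiction refl ¬p

  replace-≢ : ∀ a v x → proj₁ a ≢ proj₁ x → replace a v x ≡ [ x ]
  replace-≢ a v x ≢ with x ≟ˢ a | x ≟ˢ neg a
  ... | yes refl | _        = contradiction refl ≢
  ... | no _     | yes refl = contradiction refl ≢
  ... | no _     | no _     = refl

  replace-negate : ∀ a v x → replace a v (neg x) ≡ inv (replace a v x)
  replace-negate a v x with proj₁ a ≟ᴬ proj₁ x
  ... | no ≢ = trans (replace-≢ a v (neg x) ≢) (cong inv (sym (replace-≢ a v x ≢)))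
  ... | yes l≡ with ≡⊎≡neg x a (sym l≡)
  ...   | inj₁ refl = trans (replace-neg a v) (cong inv (sym (replace-≡ a v)))
  ...   | inj₂ refl = begin
    replace a v (neg (neg a)) ≡⟨ cong (replace a v) (neg-involutive a) ⟩
    replace a v a             ≡⟨ replace-≡ a v ⟩
    v                         ≡⟨ inv-involutive v ⟨
    inv (inv v)               ≡⟨ cong inv (replace-neg a v) ⟨
    inv (replace a v (neg a)) ∎
    where open ≡-Reasoning

  module Replace (a : A × Bool) (v : List (A × Bool)) =
    Substitution (replace a v) (replace-negate a v)

  replace*-∉ : ∀ a v xs → proj₁ a ∉ labels xs → concatMap (replace a v) xs ≡ xs
  replace*-∉ a v []       _ = refl
  replace*-∉ a v (x ∷ xs) ∉ =
    cong₂ _++_ (replace-≢ a v x (∉ ∘ here)) (replace*-∉ a v xs (∉ ∘ there))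

  replace*-++ : ∀ a v x xs ys → proj₁ a ∉ labels xs → proj₁ a ∉ labels ys →
    concatMap (replace a v) (xs ++ x ∷ ys) ≡ xs ++ replace a v x ++ ys
  replace*-++ a v x xs ys ∉xs ∉ys = trans (concatMap-++ (replace a v) xs (x ∷ ys))
    (cong₂ (λ p q → p ++ replace a v x ++ q) (replace*-∉ a v xs ∉xs) (replace*-∉ a v ys ∉ys))

  -- Locating a label in a word.

  -- The value false for an absent label is junk.
  sgn : A → List (A × Bool) → Bool
  sgn l [] = false
  sgn l ((m , s) ∷ u) = if does (l ≟ᴬ m) then s else sgn l u

  before after : A → List (A × Bool) → List (A × Bool)
  before l [] = []
  before l (x ∷ u) = if does (l ≟ᴬ proj₁ x) then [] else x ∷ before l u
  after l [] = []
  after l (x ∷ u) = if does (l ≟ᴬ proj₁ x) then u else after l u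

  split-at : ∀ {l} u → l ∈ labels u → u ≡ before l u ++ (l , sgn l u) ∷ after l u
  split-at {l} (x ∷ u) l∈ with l ≟ᴬ proj₁ x
  ... | yes refl = refl
  split-at (x ∷ u) (here l≡)  | no l≢ = contradiction l≡ l≢
  split-at (x ∷ u) (there l∈) | no _  = cong (x ∷_) (split-at u l∈)

  before-∉ : ∀ l u → l ∉ labels (before l u)
  before-∉ l (x ∷ u) l∈ with l ≟ᴬ proj₁ x
  before-∉ l (x ∷ u) (here l≡)  | no l≢ = l≢ l≡
  before-∉ l (x ∷ u) (there l∈) | no _  = before-∉ l u l∈

  after-∉ : ∀ {l} u → l ∈ labels u → Unique (labels u) → l ∉ labels (after l u)
  after-∉ {l} u l∈ uniq = Unique-∉-∷ (labels (before l u))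
    (subst Unique (trans (cong labels (split-at u l∈)) (map-++ proj₁ (before l u) _)) uniq)

  search-++ : ∀ {l} xs s ys → l ∉ labels xs → let u = xs ++ (l , s) ∷ ys in
    before l u ≡ xs × sgn l u ≡ s × after l u ≡ ys
  search-++ {l} [] s ys _ with l ≟ᴬ l
  ... | yes _ = refl , refl , refl
  ... | no ≢  = contradiction refl ≢
  search-++ {l} (x ∷ xs) s ys ∉ with l ≟ᴬ proj₁ x
  ... | yes l≡ = contradiction (here l≡) ∉
  ... | no _ with search-++ xs s ys (∉ ∘ there)
  ...   | b≡ , s≡ , a≡ = cong (x ∷_) b≡ , s≡ , a≡

  agree : A × Bool → List (A × Bool) → Bool
  agree (l , s) u = does (sgn l u Bool.≟ s)

  agree-true : ∀ x u → agree x u ≡ true → (proj₁ x , sgn (proj₁ x) u) ≡ x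
  agree-true (l , s) u eq with sgn l u Bool.≟ s
  ... | yes refl = refl

  agree-false : ∀ x u → agree x u ≡ false → (proj₁ x , sgn (proj₁ x) u) ≡ neg x
  agree-false (l , s) u eq with ≡⊎≡neg (l , sgn l u) (l , s) refl
  agree-false (l , s) u eq | inj₂ ≡neg = ≡neg
  agree-false (l , s) u eq | inj₁ ≡x with sgn l u Bool.≟ s
  ... | no ≢ = contradiction (cong proj₂ ≡x) ≢

  agree-cong : ∀ x {u v} → sgn (proj₁ x) u ≡ sgn (proj₁ x) v → agree x u ≡ agree x v
  agree-cong x = cong (λ s → does (s Bool.≟ proj₂ x))

  -- Gluing the top letter to a cyclic neighbour.

  flipAbove : A → List (A × Bool) → List (A × Bool)
  flipAbove l u = inv (before l u) ++ (l , sgn l u) ∷ after l u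

  -- The stack in which the glued pair is represented by a single pancake; being an involution, align a
  -- preserves the uniform distribution.
  align : A × Bool → List (A × Bool) → List (A × Bool)
  align a u = if agree a u then u else flipAbove (proj₁ a) u

  ∉-inv : ∀ {l} xs → l ∉ labels xs → l ∉ labels (inv xs)
  ∉-inv xs ∉ = ∉ ∘ ∈-resp-↭ (labels-inv xs)

  -- `flipAbove` reverses only what lies above the letter of `a`; that letter keeps its orientation,
  -- so the second application takes the same branch and undoes the first.
  align-involutive : ∀ a u → proj₁ a ∈ labels u → align a (align a u) ≡ u
  align-involutive a u a∈ with agree a u in eq
  ... | true rewrite eq = refl
  ... | false with search-++ {proj₁ a} (inv (before (proj₁ a) u)) (sgn (proj₁ a) u) (after (proj₁ a) u)
                   (∉-inv (before (proj₁ a) u) (before-∉ (proj₁ a) u))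
  ...   | b≡ , s≡ , a≡ rewrite agree-cong a {flipAbove (proj₁ a) u} {u} s≡ | eq | b≡ | s≡ | a≡
                             | inv-involutive (before (proj₁ a) u) = sym (split-at u a∈)

  flipAbove-labels : ∀ l u → l ∈ labels u → labels (flipAbove l u) ↭ labels u
  flipAbove-labels l u l∈ = begin
    labels (inv (before l u) ++ z)        ≡⟨ map-++ proj₁ (inv (before l u)) z ⟩
    labels (inv (before l u)) ++ labels z ↭⟨ ++⁺ʳ (labels z) (labels-inv (before l u)) ⟩
    labels (before l u) ++ labels z       ≡⟨ map-++ proj₁ (before l u) z ⟨
    labels (before l u ++ z)              ≡⟨ cong labels (split-at u l∈) ⟨
    labels u ∎
    where
    open PermutationReasoning
    z = (l , sgn l u) ∷ after l u

  align-labels : ∀ a u → proj₁ a ∈ labels u → labels (align a u) ↭ labels u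
  align-labels a u a∈ with agree a u
  ... | true  = ↭-refl
  ... | false = flipAbove-labels (proj₁ a) u a∈

  depth : A × Bool → List (A × Bool) → ℕ
  depth x u = length (before (proj₁ x) u)

  -- Depths are measured in `u`, below the top letter `b`, so a `suc` accounts for `b` or for the
  -- located letter. Below, X denotes the part of `u` above that letter.
  glue : A × Bool → A × Bool → List (A × Bool) → List ℕ
  glue a c u =
    if agree a u then
      (if agree c u
       -- The stages are `b X c`, `b̄ X c`, `X̄ b c`, `X b c`.
       then 1 ∷ suc (depth c u) ∷ depth c u ∷ []
       -- The stages are `b X c̄`, `c X̄ b̄`, `X c̄ b̄`.
       else suc (suc (depth c u)) ∷ suc (depth c u) ∷ [])
    -- One flip takes `b X ā` to `X̄ b̄ ā`.
    else [ suc (depth a u) ]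

  -- The letter that represents the glued pair from now on; `joined` is the pair it abbreviates.
  target : A × Bool → A × Bool → List (A × Bool) → A × Bool
  target a c u = if agree a u then c else a

  joined : A × Bool → A × Bool → A × Bool → List (A × Bool) → List (A × Bool)
  joined a b c u = if agree a u then b ∷ c ∷ [] else a ∷ b ∷ []

  replace-split : ∀ x v u → proj₁ x ∈ labels u → Unique (labels u) →
    concatMap (replace x v) u ≡
      before (proj₁ x) u ++ replace x v (proj₁ x , sgn (proj₁ x) u) ++ after (proj₁ x) u
  replace-split x v u x∈ uniq = trans
    (cong (concatMap (replace x v)) (split-at u x∈))
    (replace*-++ x v _ (before (proj₁ x) u) (after (proj₁ x) u) (before-∉ (proj₁ x) u) (after-∉ u x∈ uniq))

  flipL-suc : ∀ b xs ys → flipL (suc (length xs)) (b ∷ xs ++ ys) ≡ inv xs ++ neg b ∷ ys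
  flipL-suc b xs ys = trans (flipL-++ (b ∷ xs) ys)
    (trans (cong (_++ ys) (inv-∷ b xs)) (++-assoc (inv xs) [ neg b ] ys))

  flipL-inv : ∀ xs ys → flipL (length xs) (inv xs ++ ys) ≡ xs ++ ys
  flipL-inv xs ys = begin
    flipL (length xs) (inv xs ++ ys)       ≡⟨ cong (λ k → flipL k (inv xs ++ ys)) (length-inv xs) ⟨
    flipL (length (inv xs)) (inv xs ++ ys) ≡⟨ flipL-++ (inv xs) ys ⟩
    inv (inv xs) ++ ys                     ≡⟨ cong (_++ ys) (inv-involutive xs) ⟩
    xs ++ ys ∎
    where open ≡-Reasoning

  -- In each branch the flips put `b` beside the target and leave the other letters as in
  -- `align a u`. If the target occurs reversed there, the pair must appear inverted, which is how
  -- `replace` expands a negated letter.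
  glue-correct : ∀ a b c u → proj₁ a ∈ labels u → proj₁ c ∈ labels u → Unique (labels u) →
    applyL (glue a c u) (b ∷ u) ≡ concatMap (replace (target a c u) (joined a b c u)) (align a u)
  glue-correct a b c u a∈ c∈ uniq with agree a u in eqa
  ... | false = begin
    flipL (suc (length X)) (b ∷ u)         ≡⟨ cong (λ z → flipL (suc (length X)) (b ∷ z)) (split-at u a∈) ⟩
    flipL (suc (length X)) (b ∷ X ++ x ∷ Y) ≡⟨ flipL-suc b X (x ∷ Y) ⟩
    inv X ++ neg b ∷ x ∷ Y                 ≡⟨ cong (λ z → inv X ++ neg b ∷ z ∷ Y) (agree-false a u eqa) ⟩
    inv X ++ inv (a ∷ b ∷ []) ++ Y         ≡⟨ cong (λ z → inv X ++ z ++ Y) (replace-neg a (a ∷ b ∷ [])) ⟨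
    inv X ++ R (neg a) ++ Y                ≡⟨ cong (λ z → inv X ++ R z ++ Y) (agree-false a u eqa) ⟨
    inv X ++ R x ++ Y
      ≡⟨ replace*-++ a _ x (inv X) Y (∉-inv X (before-∉ (proj₁ a) u)) (after-∉ u a∈ uniq) ⟨
    concatMap R (inv X ++ x ∷ Y) ∎
    where
    open ≡-Reasoning
    X = before (proj₁ a) u
    Y = after (proj₁ a) u
    x = (proj₁ a , sgn (proj₁ a) u)
    R = replace a (a ∷ b ∷ [])
  ... | true with agree c u in eqc
  ...   | true = begin
    -- The flip of `b` alone has already been carried out by computation.
    flipL (length X) (flipL (suc (length X)) (neg b ∷ u))
      ≡⟨ cong (λ z → flipL (length X) (flipL (suc (length X)) (neg b ∷ z))) (split-at u c∈) ⟩
    flipL (length X) (flipL (suc (length X)) (neg b ∷ X ++ x ∷ Y))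
      ≡⟨ cong (flipL (length X)) (flipL-suc (neg b) X (x ∷ Y)) ⟩
    flipL (length X) (inv X ++ neg (neg b) ∷ x ∷ Y)
      ≡⟨ flipL-inv X _ ⟩
    X ++ neg (neg b) ∷ x ∷ Y
      ≡⟨ cong₂ (λ y z → X ++ y ∷ z ∷ Y) (neg-involutive b) (agree-true c u eqc) ⟩
    X ++ (b ∷ c ∷ []) ++ Y   ≡⟨ cong (λ z → X ++ z ++ Y) (replace-≡ c (b ∷ c ∷ [])) ⟨
    X ++ R c ++ Y            ≡⟨ cong (λ z → X ++ R z ++ Y) (agree-true c u eqc) ⟨
    X ++ R x ++ Y            ≡⟨ replace-split c _ u c∈ uniq ⟨
    concatMap R u ∎
    where
    open ≡-Reasoning
    X = before (proj₁ c) u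
    Y = after (proj₁ c) u
    x = (proj₁ c , sgn (proj₁ c) u)
    R = replace c (b ∷ c ∷ [])
  ...   | false = begin
    flipL (suc (length X)) (flipL (suc (suc (length X))) (b ∷ u))
      -- Here `x` is `neg c`; the first flip includes it, so the word is cut just after it.
      ≡⟨ cong (λ z → flipL (suc (length X)) (flipL (suc (suc (length X))) (b ∷ z)))
           (trans (split-at u c∈) (sym (++-assoc X [ x ] Y))) ⟩
    flipL (suc (length X)) (flipL (suc (suc (length X))) (b ∷ (X ∷ʳ x) ++ Y))
      ≡⟨ cong (λ k → flipL (suc (length X)) (flipL (suc k) (b ∷ (X ∷ʳ x) ++ Y)))
           (trans (+-comm 1 (length X)) (sym (length-++ X))) ⟩
    flipL (suc (length X)) (flipL (suc (length (X ∷ʳ x))) (b ∷ (X ∷ʳ x) ++ Y))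
      ≡⟨ cong (flipL (suc (length X))) (flipL-suc b (X ∷ʳ x) Y) ⟩
    flipL (suc (length X)) (inv (X ∷ʳ x) ++ neg b ∷ Y)
      ≡⟨ cong (λ z → flipL (suc (length X)) (z ++ neg b ∷ Y)) (inv-++ X [ x ]) ⟩
    flipL (suc (length X)) (neg x ∷ inv X ++ neg b ∷ Y)
      ≡⟨ cong (λ k → flipL (suc k) (neg x ∷ inv X ++ neg b ∷ Y)) (length-inv X) ⟨
    flipL (suc (length (inv X))) (neg x ∷ inv X ++ neg b ∷ Y)
      ≡⟨ flipL-suc (neg x) (inv X) (neg b ∷ Y) ⟩
    inv (inv X) ++ neg (neg x) ∷ neg b ∷ Y
      ≡⟨ cong₂ (λ y z → y ++ z ∷ neg b ∷ Y) (inv-involutive X)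
           (trans (neg-involutive x) (agree-false c u eqc)) ⟩
    X ++ inv (b ∷ c ∷ []) ++ Y ≡⟨ cong (λ z → X ++ z ++ Y) (replace-neg c (b ∷ c ∷ [])) ⟨
    X ++ R (neg c) ++ Y        ≡⟨ cong (λ z → X ++ R z ++ Y) (agree-false c u eqc) ⟨
    X ++ R x ++ Y              ≡⟨ replace-split c _ u c∈ uniq ⟨
    concatMap R u ∎
    where
    open ≡-Reasoning
    X = before (proj₁ c) u
    Y = after (proj₁ c) u
    x = (proj₁ c , sgn (proj₁ c) u)
    R = replace c (b ∷ c ∷ [])

  -- Reading a cycle from a given letter.

  -- If only b̄ occurs in o then the cycle is read backwards, so that rest b o always starts with the
  -- cyclic successor of b and ends with its predecessor.
  rest′ : List (A × Bool) → List (A × Bool) → A × Bool → List (A × Bool)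
  rest′ p []      b = []
  rest′ p (x ∷ q) b =
    if does (proj₁ b ≟ᴬ proj₁ x)
    then (if does (proj₂ b Bool.≟ proj₂ x) then q ++ p else inv (q ++ p))
    else rest′ (p ∷ʳ x) q b

  rest : A × Bool → List (A × Bool) → List (A × Bool)
  rest b o = rest′ [] o b

  -- `p` holds the letters already passed, so `p ++ r` stays the word being read. At the label of
  -- `b` the cycle is cut: equal signs give a rotation, opposite signs a rotation of the inverse.
  ∷-rest′-≋ : ∀ p r b → proj₁ b ∈ labels r → b ∷ rest′ p r b ≋ p ++ r
  ∷-rest′-≋ p (x ∷ q) b b∈ with proj₁ b ≟ᴬ proj₁ x
  ∷-rest′-≋ p (x ∷ q) b (here l≡)  | no l≢ = contradiction l≡ l≢
  ∷-rest′-≋ p (x ∷ q) b (there b∈) | no _  =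
    subst (b ∷ rest′ (p ∷ʳ x) q b ≋_) (++-assoc p [ x ] q) (∷-rest′-≋ (p ∷ʳ x) q b b∈)
  ∷-rest′-≋ p (x ∷ q) b _ | yes l≡ with proj₂ b Bool.≟ proj₂ x
  ... | yes s≡ = inj₁ (subst (λ y → y ∷ q ++ p ∼ p ++ x ∷ q) (sym (cong₂ _,_ l≡ s≡)) (rot p (x ∷ q)))
  ... | no s≢ with ≡⊎≡neg b x l≡
  ...   | inj₁ b≡x = contradiction (cong proj₂ b≡x) s≢
  ...   | inj₂ refl = inj₂ (subst₂ _∼_ (cong (neg x ∷_) (sym (inv-++ q p)))
            (sym (begin
              inv (p ++ x ∷ q)             ≡⟨ inv-++ p (x ∷ q) ⟩
              inv (x ∷ q) ++ inv p         ≡⟨ cong (_++ inv p) (inv-∷ x q) ⟩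
              (inv q ∷ʳ neg x) ++ inv p    ≡⟨ ++-assoc (inv q) [ neg x ] (inv p) ⟩
              inv q ++ neg x ∷ inv p ∎))
            (rot (inv q) (neg x ∷ inv p)))
    where open ≡-Reasoning

  ∷-rest-≋ : ∀ b o → proj₁ b ∈ labels o → b ∷ rest b o ≋ o
  ∷-rest-≋ b o = ∷-rest′-≋ [] o b

  ∷-rest-labels : ∀ b o → proj₁ b ∈ labels o → proj₁ b ∷ labels (rest b o) ↭ labels o
  ∷-rest-labels b o b∈ = ≋-labels (∷-rest-≋ b o b∈)

  length-rest : ∀ {n} b o → proj₁ b ∈ labels o → length o ≡ suc n → length (rest b o) ≡ n
  length-rest b o b∈ len = suc-injective (begin
    suc (length (rest b o))          ≡⟨ cong suc (length-map proj₁ (rest b o)) ⟨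
    suc (length (labels (rest b o))) ≡⟨ ↭-length (∷-rest-labels b o b∈) ⟩
    length (labels o)                ≡⟨ length-map proj₁ o ⟩
    length o                         ≡⟨ len ⟩
    _ ∎)
    where open ≡-Reasoning

  Unique-rest : ∀ b o → proj₁ b ∈ labels o → Unique (labels o) → Unique (labels (rest b o))
  Unique-rest b o b∈ uniq with Unique-resp-↭ (↭-sym (∷-rest-labels b o b∈)) uniq
  ... | _ ∷ uniq′ = uniq′

  -- The recursive algorithm and its correctness.

  -- In the cycle `b ∷ c ∷ t` this is the predecessor of `b`.
  lastOf : A × Bool → List (A × Bool) → A × Bool
  lastOf c []      = c
  lastOf c (x ∷ t) = lastOf x t

  lastOf-∷ʳ : ∀ c t → ∃[ t′ ] c ∷ t ≡ t′ ∷ʳ lastOf c t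
  lastOf-∷ʳ c [] = [] , refl
  lastOf-∷ʳ c (x ∷ t) with lastOf-∷ʳ x t
  ... | t′ , eq = c ∷ t′ , cong (c ∷_) eq

  lastOf-∈ : ∀ c t → lastOf c t ∈ c ∷ t
  lastOf-∈ c []      = here refl
  lastOf-∈ c (x ∷ t) = there (lastOf-∈ x t)

  -- The number counts the letters and drives the recursion, `o` is the goal cycle and `s` the
  -- stack. `step` has the goal cut open at the top letter `b`; it glues, sorts the stack with one
  -- letter fewer, and lifts those flips to blocks.
  sorting : ℕ → List (A × Bool) → List (A × Bool) → List ℕ
  step : ℕ → A × Bool → List (A × Bool) → List (A × Bool) → List ℕ
  sorting zero    o s       = []
  sorting (suc n) o []      = []
  sorting (suc n) o (b ∷ u) = step n b (rest b o) u
  step n b []      u = []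
  step n b (c ∷ t) u =
    glue a c u ++ Replace.lift (target a c u) (joined a b c u) (sorting n (c ∷ t) (align a u)) (align a u)
    where a = lastOf c t

  -- Expanding `c` to `b c` gives the goal itself; expanding the last letter `a` to `a b` puts `b`
  -- at the end, one rotation away.
  joined-≋ : ∀ b c t u → Unique (labels (c ∷ t)) → let a = lastOf c t in
    concatMap (replace (target a c u) (joined a b c u)) (c ∷ t) ≋ b ∷ c ∷ t
  joined-≋ b c t u uniq@(c∉ ∷ _) with agree (lastOf c t) u
  ... | true = inj₁ (subst (_∼ b ∷ c ∷ t)
    (sym (replace*-++ c (b ∷ c ∷ []) c [] t (λ ()) (λ c∈ → All.lookup c∉ c∈ refl)))
    (subst (λ z → z ++ t ∼ b ∷ c ∷ t) (sym (replace-≡ c (b ∷ c ∷ []))) ∼-refl))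
  ... | false = inj₁ (subst (λ o → concatMap (replace a (a ∷ b ∷ [])) o ∼ b ∷ o) (sym eq)
    (subst (_∼ b ∷ t′ ∷ʳ a)
      (sym (trans (replace*-++ a (a ∷ b ∷ []) a t′ [] a∉ (λ ()))
        (trans (cong (λ z → t′ ++ z ++ []) (replace-≡ a (a ∷ b ∷ []))) (sym (++-assoc t′ [ a ] [ b ])))))
      (rot [ b ] (t′ ∷ʳ a))))
    where
    a = lastOf c t
    t′ = proj₁ (lastOf-∷ʳ c t)
    eq = proj₂ (lastOf-∷ʳ c t)
    a∉ : proj₁ a ∉ labels t′
    a∉ with Unique-resp-↭ (↭-trans (↭-reflexive (map-++ proj₁ t′ [ a ])) (↭-sym (∷↭∷ʳ (proj₁ a) (labels t′))))
                          (subst (Unique ∘ labels) eq uniq)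
    ... | a∉t′ ∷ _ = λ a∈ → All.lookup a∉t′ a∈ refl

  -- `glue` reaches the expansion of `align a u`. By induction the recursive flips bring `align a u`
  -- to `c ∷ t` up to `_≋_`; substitution respects this relation, and `joined-≋` identifies the
  -- expanded goal.
  sorting-correct : ∀ n o s → length o ≡ n → Unique (labels o) → labels s ↭ labels o →
    applyL (sorting n o s) s ≋ o
  step-correct : ∀ n b o′ u → length o′ ≡ n → Unique (labels o′) → labels u ↭ labels o′ →
    applyL (step n b o′ u) (b ∷ u) ≋ b ∷ o′
  sorting-correct zero [] [] _ _ _ = inj₁ ∼-refl
  sorting-correct zero [] (x ∷ s) _ _ perm with () ← ↭-length perm
  sorting-correct (suc n) (x ∷ o) [] _ _ perm with () ← ↭-length perm
  sorting-correct (suc n) o (b ∷ u) len uniq perm = ≋-trans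
    (step-correct n b (rest b o) u (length-rest b o b∈ len) (Unique-rest b o b∈ uniq)
      (drop-∷ (↭-trans perm (↭-sym (∷-rest-labels b o b∈)))))
    (∷-rest-≋ b o b∈)
    where b∈ = ∈-resp-↭ perm (here refl)
  step-correct n b [] [] _ _ _ = inj₁ ∼-refl
  step-correct n b [] (x ∷ u) _ _ perm with () ← ↭-length perm
  step-correct n b (c ∷ t) u len uniq perm = subst (_≋ b ∷ c ∷ t) (sym eq)
    (≋-trans (R.≋-τ* (sorting-correct n (c ∷ t) (align a u) len uniq (↭-trans (align-labels a u a∈) perm)))
             (joined-≋ b c t u uniq))
    where
    a = lastOf c t
    a∈ = ∈-resp-↭ (↭-sym perm) (∈-map⁺ proj₁ (lastOf-∈ c t))
    c∈ = ∈-resp-↭ (↭-sym perm) (here refl)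
    w = sorting n (c ∷ t) (align a u)
    module R = Replace (target a c u) (joined a b c u)
    eq : applyL (step n b (c ∷ t) u) (b ∷ u) ≡ R.τ* (applyL w (align a u))
    eq = trans (applyL-++ (glue a c u) (R.lift w (align a u)) (b ∷ u))
      (trans (cong (applyL (R.lift w (align a u)))
               (glue-correct a b c u a∈ c∈ (Unique-resp-↭ (↭-sym perm) uniq)))
             (R.applyL-lift w (align a u)))

  -- The cost of a step when orientations change.

  toggleAt : A → A × Bool → A × Bool
  toggleAt m (l , s) = l , (if does (m ≟ᴬ l) then not s else s)

  toggleAt-involutive : ∀ m x → toggleAt m (toggleAt m x) ≡ x
  toggleAt-involutive m (l , s) with m ≟ᴬ l
  ... | yes _ = cong (l ,_) (not-involutive s)
  ... | no _  = refl

  toggleLabel : A → List (A × Bool) → List (A × Bool)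
  toggleLabel m = map (toggleAt m)

  toggleLabel-involutive : ∀ m u → toggleLabel m (toggleLabel m u) ≡ u
  toggleLabel-involutive m u = trans (sym (map-∘ u)) (trans (map-cong (toggleAt-involutive m) u) (map-id u))

  labels-toggle : ∀ m u → labels (toggleLabel m u) ≡ labels u
  labels-toggle m u = sym (map-∘ u)

  sgn-toggle : ∀ {m} u → m ∈ labels u → sgn m (toggleLabel m u) ≡ not (sgn m u)
  sgn-toggle {m} ((l , s) ∷ u) m∈ with m ≟ᴬ l
  ... | yes _ = refl
  sgn-toggle ((l , s) ∷ u) (here m≡)  | no m≢ = contradiction m≡ m≢
  sgn-toggle ((l , s) ∷ u) (there m∈) | no _  = sgn-toggle u m∈

  sgn-toggle-≢ : ∀ {l m} u → l ≢ m → sgn l (toggleLabel m u) ≡ sgn l u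
  sgn-toggle-≢ [] _ = refl
  sgn-toggle-≢ {l} {m} ((k , s) ∷ u) l≢m with l ≟ᴬ k | m ≟ᴬ k
  ... | yes refl | yes refl = contradiction refl l≢m
  ... | yes _    | no _     = refl
  ... | no _     | _        = sgn-toggle-≢ u l≢m

  agree-toggle : ∀ x u → proj₁ x ∈ labels u → agree x (toggleLabel (proj₁ x) u) ≡ not (agree x u)
  agree-toggle (l , s) u l∈ rewrite sgn-toggle u l∈ = flipped (sgn l u) s
    where
    flipped : ∀ p q → does (not p Bool.≟ q) ≡ not (does (p Bool.≟ q))
    flipped false false = refl
    flipped false true  = refl
    flipped true  false = refl
    flipped true  true  = refl

  agree-toggle-≢ : ∀ x m u → proj₁ x ≢ m → agree x (toggleLabel m u) ≡ agree x u
  agree-toggle-≢ x m u ≢m = agree-cong x {toggleLabel m u} {u} (sgn-toggle-≢ u ≢m)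

  cost : A × Bool → A × Bool → List (A × Bool) → ℕ
  cost a c u = length (glue a c u)

  cost-agree : ∀ a c u → cost a c u ≡ (if agree a u then (if agree c u then 3 else 2) else 1)
  cost-agree a c u with agree a u | agree c u
  ... | false | _     = refl
  ... | true  | false = refl
  ... | true  | true  = refl

  cost≤3 : ∀ a c u → cost a c u ≤ 3
  cost≤3 a c u with agree a u | agree c u
  ... | false | _     = s≤s z≤n
  ... | true  | false = s≤s (s≤s z≤n)
  ... | true  | true  = ≤-refl

  -- Reversing a and c independently runs through every case of a step: 3 + 2 + 1 + 1 = 7.
  cost-toggles : ∀ a c u → proj₁ a ≢ proj₁ c → proj₁ a ∈ labels u → proj₁ c ∈ labels u →
    (cost a c u + cost a c (toggleLabel (proj₁ a) u)) +
    (cost a c (toggleLabel (proj₁ c) u) + cost a c (toggleLabel (proj₁ a) (toggleLabel (proj₁ c) u))) ≡ 7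
  cost-toggles a c u a≢c a∈ c∈
    rewrite cost-agree a c u
          | cost-agree a c (toggleLabel (proj₁ a) u)
          | cost-agree a c (toggleLabel (proj₁ c) u)
          | cost-agree a c (toggleLabel (proj₁ a) (toggleLabel (proj₁ c) u))
          | agree-toggle a (toggleLabel (proj₁ c) u) (subst (proj₁ a ∈_) (sym (labels-toggle (proj₁ c) u)) a∈)
          | agree-toggle-≢ c (proj₁ a) (toggleLabel (proj₁ c) u) (a≢c ∘ sym)
          | agree-toggle-≢ a (proj₁ c) u a≢c
          | agree-toggle c u c∈
          | agree-toggle a u a∈
          | agree-toggle-≢ c (proj₁ a) u (a≢c ∘ sym)
    with agree a u | agree c u
  ... | false | false = refl
  ... | false | true  = refl
  ... | true  | false = refl
  ... | true  | true  = refl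

  -- Enumeration of all stacks.

  -- The part below `b` is enumerated relative to `rest b o`, the goal that `sorting` hands to
  -- `step`, so sums over stacks split along the recursion of the algorithm.
  stacks : ℕ → List (A × Bool) → List (List (A × Bool))
  stacks zero    o = [ [] ]
  stacks (suc n) o = concatMap (λ b → map (b ∷_) (stacks n (rest b o))) (o ++ map neg o)

  ±-labels : ∀ {b} o → b ∈ o ++ map neg o → proj₁ b ∈ labels o
  ±-labels o b∈ with ∈-++⁻ o b∈
  ... | inj₁ b∈o = ∈-map⁺ proj₁ b∈o
  ... | inj₂ b∈no with ∈-map⁻ neg b∈no
  ...   | _ , x∈ , refl = ∈-map⁺ proj₁ x∈

  labels-± : ∀ b o → proj₁ b ∈ labels o → b ∈ o ++ map neg o
  labels-± b o b∈ with ∈-map⁻ proj₁ b∈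
  ... | x , x∈ , eq with ≡⊎≡neg b x eq
  ...   | inj₁ refl = ∈-++⁺ˡ x∈
  ...   | inj₂ refl = ∈-++⁺ʳ o (∈-map⁺ neg x∈)

  stacks-sound : ∀ n o {s} → length o ≡ n → s ∈ stacks n o → labels s ↭ labels o
  stacks-sound zero [] _ (here refl) = ↭-refl
  stacks-sound (suc n) o len s∈
    with find (∈-concatMap⁻ (λ b → map (b ∷_) (stacks n (rest b o))) {xs = o ++ map neg o} s∈)
  ... | b , b∈± , s∈b with ∈-map⁻ (b ∷_) s∈b
  ...   | u , u∈ , refl = ↭-trans
    (prep (proj₁ b) (stacks-sound n (rest b o) (length-rest b o (±-labels o b∈±) len) u∈))
    (∷-rest-labels b o (±-labels o b∈±))

  stacks-complete : ∀ n o {s} → length o ≡ n → labels s ↭ labels o → s ∈ stacks n o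
  stacks-complete zero [] {[]} _ _ = here refl
  stacks-complete zero [] {x ∷ s} _ perm with () ← ↭-length perm
  stacks-complete (suc n) (x ∷ o) {[]} _ perm with () ← ↭-length perm
  stacks-complete (suc n) o {b ∷ u} len perm = ∈-concatMap⁺ _ (lose (labels-± b o b∈)
    (∈-map⁺ (b ∷_) (stacks-complete n (rest b o) (length-rest b o b∈ len)
      (drop-∷ (↭-trans perm (↭-sym (∷-rest-labels b o b∈)))))))
    where b∈ = ∈-resp-↭ perm (here refl)

  label-injective : ∀ {o x y} → Unique (labels o) → x ∈ o → y ∈ o → proj₁ x ≡ proj₁ y → x ≡ y
  label-injective _ (here refl) (here refl) _ = refl
  label-injective (x∉ ∷ _) (here refl) (there y∈) eq = contradiction eq (All.lookup x∉ (∈-map⁺ proj₁ y∈))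
  label-injective (y∉ ∷ _) (there x∈) (here refl) eq = contradiction (sym eq) (All.lookup y∉ (∈-map⁺ proj₁ x∈))
  label-injective (_ ∷ uniq) (there x∈) (there y∈) eq = label-injective uniq x∈ y∈ eq

  -- Labels in `o` are distinct, so a letter common to both halves would equal its own negation.
  Unique-± : ∀ o → Unique (labels o) → Unique (o ++ map neg o)
  Unique-± o uniq = Unique.++⁺ (Unique.map⁻ uniq) (Unique.map⁺ neg-injective (Unique.map⁻ uniq)) disjoint
    where
    neg-injective : ∀ {x y} → neg x ≡ neg y → x ≡ y
    neg-injective {x} {y} eq = trans (sym (neg-involutive x)) (trans (cong neg eq) (neg-involutive y))
    disjoint : ∀ {x} → ¬ (x ∈ o × x ∈ map neg o)
    disjoint (x∈ , x∈neg) with ∈-map⁻ neg x∈neg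
    ... | y , y∈ , refl = neg≢ y (label-injective uniq x∈ y∈ refl)

  stacks-unique : ∀ n o → length o ≡ n → Unique (labels o) → Unique (stacks n o)
  stacks-unique zero    o _   _    = [] ∷ []
  stacks-unique (suc n) o len uniq = Unique-concatMap _∷_ (λ b → stacks n (rest b o)) ∷-injective
    (o ++ map neg o) (Unique-± o uniq)
    λ {b} b∈ → stacks-unique n (rest b o) (length-rest b o (±-labels o b∈) len)
                 (Unique-rest b o (±-labels o b∈) uniq)

  -- The average number of flips.

  N : ℕ → ℕ
  N n = n ! * 2 ^ n

  length-± : ∀ o → length (o ++ map neg o) ≡ 2 * length o
  length-± o = begin
    length (o ++ map neg o)       ≡⟨ length-++ o ⟩
    length o + length (map neg o) ≡⟨ cong (length o +_) (length-map neg o) ⟩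
    length o + length o           ≡⟨ cong (length o +_) (+-identityʳ (length o)) ⟨
    2 * length o ∎
    where open ≡-Reasoning

  N-suc : ∀ n → 2 * suc n * N n ≡ N (suc n)
  N-suc n = rearrange (suc n) (n !) (2 ^ n)
    where
    rearrange : ∀ m f p → 2 * m * (f * p) ≡ m * f * (2 * p)
    rearrange = solve-∀

  -- There are `2 * suc n` signed letters to choose as top, each contributing at most `K`. The
  -- factor `k` clears denominators: it is 4 for costs and 1 for counting.
  sum-stacks≤ : ∀ n o {f : List (A × Bool) → ℕ} {K} k → length o ≡ suc n →
    (∀ {b} → b ∈ o ++ map neg o → k * sum (map (f ∘ (b ∷_)) (stacks n (rest b o))) ≤ K) →
    k * sum (map f (stacks (suc n) o)) ≤ 2 * suc n * K
  sum-stacks≤ n o {f} {K} k len bound = begin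
    k * sum (map f (stacks (suc n) o))
      ≡⟨ cong (k *_) (sum-map-concatMap f (λ b → map (b ∷_) (stacks n (rest b o))) ±o) ⟩
    k * sum (map (λ b → sum (map f (map (b ∷_) (stacks n (rest b o))))) ±o)
      ≤⟨ sum-bound ±o (λ {b} b∈ → ≤-trans
           (≤-reflexive (cong (λ z → k * sum z) (sym (map-∘ (stacks n (rest b o)))))) (bound b∈)) ⟩
    length ±o * K
      ≡⟨ cong (_* K) (trans (length-± o) (cong (2 *_) len)) ⟩
    2 * suc n * K ∎
    where
    open ≤-Reasoning
    ±o = o ++ map neg o
    sum-bound : ∀ {X : Set} {g : X → ℕ} xs → (∀ {x} → x ∈ xs → k * g x ≤ K) →
      k * sum (map g xs) ≤ length xs * K
    sum-bound [] _ = ≤-reflexive (*-zeroʳ k)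
    sum-bound {g = g} (x ∷ xs) h = ≤-trans (≤-reflexive (*-distribˡ-+ k (g x) _))
      (+-mono-≤ (h (here refl)) (sum-bound xs (h ∘ there)))

  -- Written as a sum of ones, the length falls under `sum-stacks≤`.
  length-stacks≤ : ∀ n o → length o ≡ n → length (stacks n o) ≤ N n
  length-stacks≤ n o len = ≤-trans
    (≤-reflexive (sym (trans (+-identityʳ _) (trans (sum-map-const 1 (stacks n o)) (*-identityʳ _)))))
    (go n o len)
    where
    go : ∀ n o → length o ≡ n → 1 * sum (map (λ _ → 1) (stacks n o)) ≤ N n
    go zero    o len = ≤-refl
    go (suc n) o len = ≤-trans
      (sum-stacks≤ n o 1 len λ {b} b∈ → go n (rest b o) (length-rest b o (±-labels o b∈) len))
      (≤-reflexive (N-suc n))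

  -- Reversing `a`, `c` or both permutes the stacks, so four copies of the sum can be reindexed by
  -- the four choices; then `cost-toggles` gives 7 for every stack.
  sum-cost≤ : ∀ n o a c → length o ≡ n → Unique (labels o) → a ∈ o → c ∈ o → proj₁ a ≢ proj₁ c →
    4 * sum (map (cost a c) (stacks n o)) ≤ 7 * N n
  sum-cost≤ n o a c len uniq a∈ c∈ a≢c = begin
    4 * sum (map f xs)
      ≡⟨ four (sum (map f xs)) ⟩
    (sum (map f xs) + sum (map f xs)) + (sum (map f xs) + sum (map f xs))
      ≤⟨ +-mono-≤ (+-monoʳ-≤ (sum (map f xs)) (toggle≤ f (proj₁ a)))
           (+-mono-≤ (toggle≤ f (proj₁ c))
             (≤-trans (toggle≤ f (proj₁ a)) (toggle≤ (f ∘ toggleLabel (proj₁ a)) (proj₁ c)))) ⟩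
    (sum (map f xs) + sum (map fa xs)) + (sum (map fc xs) + sum (map fac xs))
      ≡⟨ cong₂ _+_ (sum-map-+ f fa xs) (sum-map-+ fc fac xs) ⟨
    sum (map (λ u → f u + fa u) xs) + sum (map (λ u → fc u + fac u) xs)
      ≡⟨ sum-map-+ (λ u → f u + fa u) (λ u → fc u + fac u) xs ⟨
    sum (map (λ u → (f u + fa u) + (fc u + fac u)) xs)
      ≤⟨ sum-map-mono xs (λ {u} u∈ → ≤-reflexive (cost-toggles a c u a≢c (in-labels a∈ u∈) (in-labels c∈ u∈))) ⟩
    sum (map (λ _ → 7) xs)
      ≡⟨ sum-map-const 7 xs ⟩
    length xs * 7
      ≡⟨ *-comm (length xs) 7 ⟩
    7 * length xs
      ≤⟨ *-monoʳ-≤ 7 (length-stacks≤ n o len) ⟩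
    7 * N n ∎
    where
    open ≤-Reasoning
    xs = stacks n o
    f = cost a c
    fa = f ∘ toggleLabel (proj₁ a)
    fc = f ∘ toggleLabel (proj₁ c)
    fac = f ∘ toggleLabel (proj₁ a) ∘ toggleLabel (proj₁ c)
    four : ∀ x → 4 * x ≡ (x + x) + (x + x)
    four = solve-∀
    in-labels : ∀ {x u} → x ∈ o → u ∈ xs → proj₁ x ∈ labels u
    in-labels x∈ u∈ = ∈-resp-↭ (↭-sym (stacks-sound n o len u∈)) (∈-map⁺ proj₁ x∈)
    toggle≤ : ∀ (g : List (A × Bool) → ℕ) m → sum (map g xs) ≤ sum (map (g ∘ toggleLabel m) xs)
    toggle≤ g m = sum≤sum-involution g (toggleLabel m) (stacks-unique n o len uniq)
      (λ {u} u∈ → stacks-complete n o len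
        (subst (_↭ labels o) (sym (labels-toggle m u)) (stacks-sound n o len u∈)))
      (λ {u} _ → toggleLabel-involutive m u)

  length-step : ∀ n b c t u → let a = lastOf c t in
    length (step n b (c ∷ t) u) ≡ cost a c u + length (sorting n (c ∷ t) (align a u))
  length-step n b c t u = trans (length-++ (glue a c u))
    (cong (cost a c u +_) (Replace.length-lift (target a c u) (joined a b c u) (sorting n (c ∷ t) (align a u)) (align a u)))
    where a = lastOf c t

  -- For two pancakes a and c coincide and the mean of 7/4 is exceeded; this is made up for by the fact
  -- that a single pancake needs no step at all.
  length-sorting-1 : ∀ c s → length (sorting 1 [ c ] s) ≡ 0
  length-sorting-1 c [] = refl
  length-sorting-1 c (b ∷ u) with does (proj₁ b ≟ᴬ proj₁ c) | does (proj₂ b Bool.≟ proj₂ c)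
  ... | true  | true  = refl
  ... | true  | false = refl
  ... | false | _     = refl

  -- Mutual induction: `sum-sorting≤` adds up over the top letter, and `sum-step≤` adds the gluing
  -- cost, at most 7/4 on average once two letters lie below `b`, to the cost of sorting what
  -- remains.
  sum-sorting≤ : ∀ n o → length o ≡ n → Unique (labels o) →
    4 * sum (map (length ∘ sorting n o) (stacks n o)) ≤ 7 * n * N n
  sum-step≤ : ∀ n b o → length o ≡ n → Unique (labels o) →
    4 * sum (map (length ∘ step n b o) (stacks n o)) ≤ 7 * suc n * N n

  sum-sorting≤ zero    o len uniq = z≤n
  sum-sorting≤ (suc n) o len uniq = ≤-trans
    (sum-stacks≤ n o 4 len λ {b} b∈ →
      sum-step≤ n b (rest b o) (length-rest b o (±-labels o b∈) len) (Unique-rest b o (±-labels o b∈) uniq))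
    (≤-reflexive (trans (rearrange (2 * suc n) (7 * suc n) (N n)) (cong (7 * suc n *_) (N-suc n))))
    where
    rearrange : ∀ x y z → x * (y * z) ≡ y * (x * z)
    rearrange = solve-∀

  sum-step≤ zero b [] len uniq = z≤n
  sum-step≤ (suc zero) b (c ∷ []) len uniq = begin
    4 * sum (map (length ∘ step 1 b [ c ]) xs)
      ≤⟨ *-monoʳ-≤ 4 (sum-map-mono xs λ {u} _ → ≤-trans
           (≤-reflexive (trans (length-step 1 b c [] u)
             (trans (cong (cost c c u +_) (length-sorting-1 c (align c u))) (+-identityʳ _))))
           (cost≤3 c c u)) ⟩
    4 * sum (map (λ _ → 3) xs) ≡⟨ cong (4 *_) (sum-map-const 3 xs) ⟩
    4 * (length xs * 3)        ≤⟨ *-monoʳ-≤ 4 (*-monoˡ-≤ 3 (length-stacks≤ 1 [ c ] refl)) ⟩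
    -- At most two stacks with at most 3 flips each give 4 · 2 · 3 = 24, within the allowed 7 · 2 ·
    -- 2 = 28.
    24                         ≤⟨ m≤m+n 24 4 ⟩
    28 ∎
    where
    open ≤-Reasoning
    xs = stacks 1 [ c ]
  sum-step≤ n@(suc (suc _)) b o@(c ∷ t@(d ∷ t′)) len uniq@(c∉ ∷ _) = begin
    4 * sum (map (length ∘ step n b o) xs)
      ≡⟨ cong (λ z → 4 * sum z) (map-cong (length-step n b c t) xs) ⟩
    4 * sum (map (λ u → cost a c u + (length ∘ sorting n o) (align a u)) xs)
      ≡⟨ cong (4 *_) (sum-map-+ (cost a c) (length ∘ sorting n o ∘ align a) xs) ⟩
    4 * (sum (map (cost a c) xs) + sum (map (length ∘ sorting n o ∘ align a) xs))
      ≡⟨ *-distribˡ-+ 4 (sum (map (cost a c) xs)) _ ⟩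
    4 * sum (map (cost a c) xs) + 4 * sum (map (length ∘ sorting n o ∘ align a) xs)
      ≤⟨ +-mono-≤ (sum-cost≤ n o a c len uniq (lastOf-∈ c t) (here refl) a≢c)
           (≤-trans (*-monoʳ-≤ 4 align-reindex) (sum-sorting≤ n o len uniq)) ⟩
    7 * N n + 7 * n * N n
      ≡⟨ rearrange n (N n) ⟩
    7 * suc n * N n ∎
    where
    open ≤-Reasoning
    xs = stacks n o
    a = lastOf c t
    a≢c : proj₁ a ≢ proj₁ c
    a≢c a≡c = All.lookup c∉ (∈-map⁺ proj₁ (lastOf-∈ d t′)) (sym a≡c)
    rearrange : ∀ n m → 7 * m + 7 * n * m ≡ 7 * suc n * m
    rearrange = solve-∀
    a∈ : ∀ {u} → u ∈ xs → proj₁ a ∈ labels u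
    a∈ u∈ = ∈-resp-↭ (↭-sym (stacks-sound n o len u∈)) (∈-map⁺ proj₁ (lastOf-∈ c t))
    -- `align a` is an involution on the stacks, so the recursive call sees each stack at most once.
    align-reindex : sum (map (length ∘ sorting n o ∘ align a) xs) ≤ sum (map (length ∘ sorting n o) xs)
    align-reindex = sum-injection≤ (length ∘ sorting n o) (align a) (stacks-unique n o len uniq)
      (λ {u} u∈ → stacks-complete n o len (↭-trans (align-labels a u (a∈ u∈)) (stacks-sound n o len u∈)))
      (λ {u} {v} u∈ v∈ eq → trans (sym (align-involutive a u (a∈ u∈)))
        (trans (cong (align a) eq) (align-involutive a v (a∈ v∈))))

-- Indexing of lists.

-- Indices are plain numbers, with `nothing` out of range, so positions in `take`, `drop` and
-- `reverse` can be compared without bounds in their types.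
nth : ∀ {A : Set} → ℕ → List A → Maybe A
nth _       []       = nothing
nth zero    (x ∷ xs) = just x
nth (suc k) (x ∷ xs) = nth k xs

nth-++ˡ : ∀ {A : Set} {k} (xs ys : List A) → k < length xs → nth k (xs ++ ys) ≡ nth k xs
nth-++ˡ {k = zero}  (x ∷ xs) ys _         = refl
nth-++ˡ {k = suc k} (x ∷ xs) ys (s≤s k<n) = nth-++ˡ xs ys k<n

nth-++ʳ : ∀ {A : Set} k (xs ys : List A) → nth (length xs + k) (xs ++ ys) ≡ nth k ys
nth-++ʳ k []       ys = refl
nth-++ʳ k (x ∷ xs) ys = nth-++ʳ k xs ys

nth-map : ∀ {A B : Set} (f : A → B) k xs → nth k (map f xs) ≡ Maybe.map f (nth k xs)
nth-map f k       []       = refl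
nth-map f zero    (x ∷ xs) = refl
nth-map f (suc k) (x ∷ xs) = nth-map f k xs

nth-take : ∀ {A : Set} {j k} (xs : List A) → j < k → nth j (take k xs) ≡ nth j xs
nth-take {k = suc k} [] _ = refl
nth-take {j = zero}  {suc k} (x ∷ xs) _ = refl
nth-take {j = suc j} {suc k} (x ∷ xs) (s≤s j<k) = nth-take xs j<k

nth-drop : ∀ {A : Set} j k (xs : List A) → nth j (drop k xs) ≡ nth (k + j) xs
nth-drop j zero    xs       = refl
nth-drop j (suc k) []       = refl
nth-drop j (suc k) (x ∷ xs) = nth-drop j k xs

nth-reverse : ∀ {A : Set} j (xs : List A) → j < length xs →
  nth j (reverse xs) ≡ nth (length xs ∸ suc j) xs
nth-reverse j (x ∷ xs) j<n rewrite unfold-reverse x xs with j <? length xs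
... | yes j<m = begin
  nth j (reverse xs ∷ʳ x)
    ≡⟨ nth-++ˡ (reverse xs) [ x ] (subst (j <_) (sym (length-reverse xs)) j<m) ⟩
  nth j (reverse xs)                 ≡⟨ nth-reverse j xs j<m ⟩
  nth (length xs ∸ suc j) xs         ≡⟨⟩
  nth (suc (length xs ∸ suc j)) (x ∷ xs) ≡⟨ cong (λ k → nth k (x ∷ xs)) (+-∸-assoc 1 j<m) ⟨
  nth (length xs ∸ j) (x ∷ xs) ∎
  where open ≡-Reasoning
... | no j≮m with ≤-antisym (≤-pred j<n) (≮⇒≥ j≮m)
...   | refl = begin
  nth (length xs) (reverse xs ∷ʳ x)
    ≡⟨ cong (λ k → nth k (reverse xs ∷ʳ x)) (trans (+-identityʳ _) (length-reverse xs)) ⟨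
  nth (length (reverse xs) + 0) (reverse xs ∷ʳ x) ≡⟨ nth-++ʳ 0 (reverse xs) [ x ] ⟩
  just x                                    ≡⟨ cong (λ k → nth k (x ∷ xs)) (n∸n≡0 (length xs)) ⟨
  nth (length xs ∸ length xs) (x ∷ xs) ∎
  where open ≡-Reasoning

nth-toList : ∀ {A : Set} {n} (v : Vec A n) i → nth (toℕ i) (toList v) ≡ just (lookup v i)
nth-toList (x ∷ v) zero    = refl
nth-toList (x ∷ v) (suc i) = nth-toList v i

nth-ext : ∀ {A : Set} {n} (v : Vec A n) xs → length xs ≡ n →
  (∀ i → just (lookup v i) ≡ nth (toℕ i) xs) → toList v ≡ xs
nth-ext []      []       _   _  = refl
nth-ext (x ∷ v) (y ∷ xs) len eq with eq zero
... | refl = cong (x ∷_) (nth-ext v xs (suc-injective len) (eq ∘ suc))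

-- From words back to vectors of pancakes.

open module PancakeWords {n : ℕ} = Words (_≟_ {n})

-- Entries are compared one by one: above the cut `K`, entry `i` is the negated entry `K ∸ suc i` of
-- the stack; below it nothing changes.
toList-flip : ∀ {n} (k : Fin (suc n)) (C : RawStack n) → toList (flip k C) ≡ flipL (toℕ k) (toList C)
toList-flip {n} k C = nth-ext (flip k C) (inv (take K l) ++ drop K l) len pointwise
  where
  open ≡-Reasoning
  K = toℕ k
  l = toList C
  length-prefix : length (take K l) ≡ K
  length-prefix = trans (length-take K l)
    (m≤n⇒m⊓n≡m (≤-trans (≤-pred (toℕ<n k)) (≤-reflexive (sym (length-toList C)))))
  length-inv-prefix : length (inv (take K l)) ≡ K
  length-inv-prefix = trans (length-inv (take K l)) length-prefix
  len : length (inv (take K l) ++ drop K l) ≡ n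
  len = begin
    length (inv (take K l) ++ drop K l) ≡⟨ length-++ (inv (take K l)) ⟩
    length (inv (take K l)) + length (drop K l) ≡⟨ cong (_+ length (drop K l)) (length-inv (take K l)) ⟩
    length (take K l) + length (drop K l) ≡⟨ length-++ (take K l) ⟨
    length (take K l ++ drop K l) ≡⟨ cong length (take++drop≡id K l) ⟩
    length l ≡⟨ length-toList C ⟩
    n ∎
  pointwise : ∀ j → just (lookup (flip k C) j) ≡ nth (toℕ j) (inv (take K l) ++ drop K l)
  nth-fromℕ< : ∀ m (m<n : m < n) → just (lookup C (fromℕ< m<n)) ≡ nth m l
  nth-fromℕ< m m<n = trans (sym (nth-toList C (fromℕ< m<n))) (cong (λ i → nth i l) (toℕ-fromℕ< m<n))
  -- The ascription exposes the unnamed local function of Defs.flip, on which the case split acts.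
  pointwise j with toℕ j <? K | (lookup (flip k C) j ≡ _ ∋ lookup∘tabulate _ j)
  ... | yes j<K | eq = begin
    -- `toggle` and `neg` agree by computation.
    just (lookup (flip k C) j)                     ≡⟨ cong just eq ⟩
    Maybe.map neg (just (lookup C (fromℕ< i′<n))) ≡⟨ cong (Maybe.map neg) (nth-fromℕ< (K ∸ suc i) i′<n) ⟩
    Maybe.map neg (nth (K ∸ suc i) l)
      ≡⟨ cong (Maybe.map neg) (nth-take l i′<K) ⟨
    Maybe.map neg (nth (K ∸ suc i) (take K l))     ≡⟨ nth-map neg (K ∸ suc i) (take K l) ⟨
    nth (K ∸ suc i) (map neg (take K l))
      ≡⟨ cong (λ m → nth (m ∸ suc i) (map neg (take K l))) length-negated ⟨
    nth (length (map neg (take K l)) ∸ suc i) (map neg (take K l))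
      ≡⟨ nth-reverse i (map neg (take K l)) (subst (i <_) (sym length-negated) j<K) ⟨
    nth i (inv (take K l))
      ≡⟨ nth-++ˡ (inv (take K l)) (drop K l) (subst (i <_) (sym length-inv-prefix) j<K) ⟨
    nth i (inv (take K l) ++ drop K l) ∎
    where
    i = toℕ j
    i′<K : K ∸ suc i < K
    i′<K = ∸-monoʳ-< (s≤s z≤n) j<K
    i′<n : K ∸ suc i < n
    i′<n = <-≤-trans i′<K (≤-pred (toℕ<n k))
    length-negated : length (map neg (take K l)) ≡ K
    length-negated = trans (length-map neg (take K l)) length-prefix
  ... | no j≮K | eq = begin
    just (lookup (flip k C) j)  ≡⟨ cong just eq ⟩
    just (lookup C j)           ≡⟨ nth-toList C j ⟨
    nth (toℕ j) l               ≡⟨ cong (λ m → nth m l) (m+[n∸m]≡n (≮⇒≥ j≮K)) ⟨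
    nth (K + i) l               ≡⟨ nth-drop i K l ⟨
    nth i (drop K l)            ≡⟨ nth-++ʳ i (inv (take K l)) (drop K l) ⟨
    nth (length (inv (take K l)) + i) (inv (take K l) ++ drop K l)
      ≡⟨ cong (λ m → nth m (inv (take K l) ++ drop K l))
           (trans (cong (_+ i) length-inv-prefix) (m+[n∸m]≡n (≮⇒≥ j≮K))) ⟩
    nth (toℕ j) (inv (take K l) ++ drop K l) ∎
    where i = toℕ j ∸ K

flipL-⊓ : ∀ {n} k (s : List (Pancake n)) → flipL (k ⊓ length s) s ≡ flipL k s
flipL-⊓ k s with ≤-total k (length s)
... | inj₁ k≤ rewrite m≤n⇒m⊓n≡m k≤ = refl
... | inj₂ ≥k rewrite m≥n⇒m⊓n≡n ≥k =
  cong₂ (λ a b → inv a ++ b)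
    (trans (take-all (length s) s ≤-refl) (sym (take-all k s ≥k)))
    (trans (drop-all (length s) s ≤-refl) (sym (drop-all k s ≥k)))

-- flipL k already flips the whole stack when k exceeds its height.
clamp : (n : ℕ) → ℕ → Fin (suc n)
clamp n k = fromℕ< {k ⊓ n} (s≤s (m⊓n≤n k n))

toList-applyFlips : ∀ {n} ks (C : RawStack n) →
  toList (applyFlips (map (clamp n) ks) C) ≡ applyL ks (toList C)
toList-applyFlips []       C = refl
toList-applyFlips {n} (k ∷ ks) C = trans (toList-applyFlips ks (flip (clamp n k) C)) (cong (applyL ks) (begin
  toList (flip (clamp n k) C)              ≡⟨ toList-flip (clamp n k) C ⟩
  flipL (toℕ (clamp n k)) (toList C)       ≡⟨ cong (λ m → flipL m (toList C)) (toℕ-fromℕ< (s≤s (m⊓n≤n k n))) ⟩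
  flipL (k ⊓ n) (toList C)                 ≡⟨ cong (λ m → flipL (k ⊓ m) (toList C)) (length-toList C) ⟨
  flipL (k ⊓ length (toList C)) (toList C) ≡⟨ flipL-⊓ k (toList C) ⟩
  flipL k (toList C) ∎))
  where open ≡-Reasoning

toList-inj : ∀ {A : Set} {n} {v w : Vec A n} → toList v ≡ toList w → v ≡ w
toList-inj {v = v} {w} eq = trans (sym (cast-is-id refl v)) (toList-injective refl v w eq)

sizes-labels : ∀ {n} (C : RawStack n) → sizes C ≡ labels (toList C)
sizes-labels C = toList-map proj₁ C

sizes-I : ∀ n → sizes (I n) ≡ allFin n
sizes-I n = trans (cong toList (sym (tabulate-∘ proj₁ (λ i → (i , false))))) (toList-tabulate n id)
  where
  toList-tabulate : ∀ {A : Set} n (f : Fin n → A) → toList (tabulate f) ≡ List.tabulate f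
  toList-tabulate zero    f = refl
  toList-tabulate (suc n) f = cong (f zero ∷_) (toList-tabulate n (f ∘ suc))

-- By pigeonhole, `n` distinct sizes exhaust `Fin n`.
IsStack⇒↭ : ∀ {n} (C : RawStack n) → IsStack C → labels (toList C) ↭ labels (toList (I n))
IsStack⇒↭ {n} C uniq = begin
  labels (toList C)     ≡⟨ sizes-labels C ⟨
  sizes C               ↭⟨ Unique-⊆-↭ uniq (λ {i} _ → ∈-allFin i) (≤-reflexive
                             (trans (length-tabulate id) (sym (length-toList (Vec.map proj₁ C))))) ⟩
  allFin n              ≡⟨ sizes-I n ⟨
  sizes (I n)           ≡⟨ sizes-labels (I n) ⟩
  labels (toList (I n)) ∎
  where open PermutationReasoning

labels-I-unique : ∀ n → Unique (labels (toList (I n)))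
labels-I-unique n = subst Unique (trans (sym (sizes-I n)) (sizes-labels (I n))) (Unique.allFin⁺ n)

-- The algorithm on stacks and the final bound.

allVecs-unique : ∀ {A : Set} {xs : List A} → Unique xs → ∀ m → Unique (allVecs xs m)
allVecs-unique uniq zero    = [] ∷ []
allVecs-unique uniq (suc m) = Unique-concatMap _∷_ _ ∷ᵛ-injective _ uniq (λ _ → allVecs-unique uniq m)

allStacks-unique : ∀ n → Unique (allStacks n)
allStacks-unique n = Unique.filter⁺ (λ C → UniqueDec.unique? _≟_ (sizes C))
  (allVecs-unique (Unique.cartesianProduct⁺ (Unique.allFin⁺ n) (((λ ()) ∷ []) ∷ [] ∷ [])) n)

sort : ∀ {n} → RawStack n → List ℕ
sort {n} C = sorting n (toList (I n)) (toList C)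

sort-≋ : ∀ {n} (C : RawStack n) → IsStack C → applyL (sort C) (toList C) ≋ toList (I n)
sort-≋ {n} C p = sorting-correct n (toList (I n)) (toList C) (length-toList (I n)) (labels-I-unique n) (IsStack⇒↭ C p)

-- The decision is an argument so that proofs can split on it; a vector with repeated sizes gets the
-- empty sequence by default.
solve : ∀ {n} (C : RawStack n) → Dec (IsStack C) → List ℕ
solve C (yes p) = sort C ++ proj₁ (finish (sort-≋ C p))
solve C (no _)  = []

solve-correct : ∀ {n} (C : RawStack n) d → IsStack C → applyL (solve C d) (toList C) ≡ toList (I n)
solve-correct C (yes p) _ = trans (applyL-++ (sort C) _ (toList C)) (proj₁ (proj₂ (finish (sort-≋ C p))))
solve-correct C (no ¬p) p = contradiction p ¬p

length-solve : ∀ {n} (C : RawStack n) d → length (solve C d) ≤ length (sort C) + 4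
length-solve C (yes p) = ≤-trans (≤-reflexive (length-++ (sort C)))
  (+-monoʳ-≤ (length (sort C)) (proj₂ (proj₂ (finish (sort-≋ C p)))))
length-solve C (no _) = z≤n

isStack? : ∀ {n} (C : RawStack n) → Dec (IsStack C)
isStack? {n} C = UniqueDec.unique? (_≟_ {n}) (sizes C)

theorem3 : (n : ℕ) → 1 ≤ n →
    Σ[ alg ∈ (RawStack n → List (Fin (1 + n))) ]
    (((C : RawStack n) → IsStack C → applyFlips (alg C) C ≡ I n)
    × (4 * totalLength alg ≤ (7 * n + 20) * ((n !) * 2 ^ n)))
theorem3 n _ = flips , correct , bound
  where
  flips : RawStack n → List (Fin (1 + n))
  flips C = map (clamp n) (solve C (isStack? C))
  correct : ∀ C → IsStack C → applyFlips (flips C) C ≡ I n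
  correct C p = toList-inj (trans (toList-applyFlips (solve C (isStack? C)) C) (solve-correct C (isStack? C) p))
  open ≤-Reasoning
  o = toList (I n)
  len = length-toList (I n)
  f = length ∘ sorting n o
  xs = stacks n o
  bound : 4 * totalLength flips ≤ (7 * n + 20) * (n ! * 2 ^ n)
  bound = begin
    4 * sum (map (length ∘ flips) (allStacks n))
      -- The summand 4 pays for the flips of `finish`.
      ≤⟨ *-monoʳ-≤ 4 (sum-map-mono (allStacks n) λ {C} _ → ≤-trans
           (≤-reflexive (length-map (clamp n) (solve C (isStack? C)))) (length-solve C (isStack? C))) ⟩
    4 * sum (map (λ C → f (toList C) + 4) (allStacks n))
      -- `toList` embeds the given enumeration into `stacks n o`, which follows the recursion of the
      -- algorithm.
      ≤⟨ *-monoʳ-≤ 4 (sum-injection≤ (λ s → f s + 4) toList (allStacks-unique n)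
           (λ {C} C∈ → stacks-complete n o len (IsStack⇒↭ C (proj₂ (∈-filter⁻ isStack? {xs = allVecs _ n} C∈))))
           (λ _ _ → toList-inj)) ⟩
    4 * sum (map (λ s → f s + 4) xs)
      ≡⟨ cong (4 *_) (trans (sum-map-+ f (λ _ → 4) xs) (cong (sum (map f xs) +_) (sum-map-const 4 xs))) ⟩
    4 * (sum (map f xs) + length xs * 4)
      ≡⟨ *-distribˡ-+ 4 (sum (map f xs)) _ ⟩
    4 * sum (map f xs) + 4 * (length xs * 4)
      ≤⟨ +-mono-≤ (sum-sorting≤ n o len (labels-I-unique n)) (*-monoʳ-≤ 4 (*-monoˡ-≤ 4 (length-stacks≤ n o len))) ⟩
    7 * n * (n ! * 2 ^ n) + 4 * (n ! * 2 ^ n * 4)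
      ≡⟨ rearrange n (n ! * 2 ^ n) ⟩
    (7 * n + 16) * (n ! * 2 ^ n)
      -- The argument yields 7/4 n + 4, which is relaxed to 7/4 n + 5.
      ≤⟨ *-monoˡ-≤ (n ! * 2 ^ n) (+-monoʳ-≤ (7 * n) (m≤m+n 16 4)) ⟩
    (7 * n + 20) * (n ! * 2 ^ n) ∎
    where
    rearrange : ∀ n m → 7 * n * m + 4 * (m * 4) ≡ (7 * n + 16) * m
    rearrange = solve-∀
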